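{- Let $\lambda_1$ and $\lambda_2$ be computons. Then $\lambda_1$ and $\lambda_2$ are connected computons if and only if the p-async computon $\lambda_1+\lambda_2$ exists.
   Context: $\mathbf{Set}$ is the category of finite sets and total functions. A computon $\lambda$ is a tuple $(U,P,I,O,\Sigma,\sigma,\tau,t,s,c)$ (a functor into $\mathbf{Set}$ from the free category on the arrows $\sigma:O\to U$, $\tau:I\to U$, $t:O\to P$, $s:I\to P$, $c:P\to\Sigma$) where $U$ (computation units), $I$ and $O$ (edges) are possibly empty finite sets, $P$ (ports) is a non-empty finite set, $\Sigma\subset\mathbb{N}$ (colours) is finite with $0\in\Sigma$, the functions $\sigma,\tau,c$ are surjective, and: the restrictions $\sigma|_{(c\circ t)^{ -1}(0)}$ and $\tau|_{(c\circ s)^{ -1}(0)}$ are surjective onto $U$; there is $p\in P\setminus \mathrm{Im}(s)$ with $c(p)=0$; there is $q\in P\setminus \mathrm{Im}(t)$ with $c(q)=0$. Components of $\lambda_j$ carry the subscript $j$. Put $P^+=P\setminus \mathrm{Im}(t)$ (e-inports) and $P^-=P\setminus \mathrm{Im}(s)$ (e-outports). Write $p\xrightarrow{i}u$ if $s(i)=p,\ \tau(i)=u$, and $u\xrightarrow{o}p$ if $\sigma(o)=u,\ t(o)=p$. For a port $p$, $\bullet p=\{u\in U\mid \exists o\in O,\ u\xrightarrow{o}p\}$ and $p\bullet=\{u\in U\mid\exists i\in I,\ p\xrightarrow{i}u\}$. Write $p_1\xrightarrow{\exists}p_n$ if there is a chain $p_1\xrightarrow{i_1}u_1\xrightarrow{o_1}p_2\cdots\xrightarrow{i_{n-1}}u_{n-1}\xrightarrow{o_{n-1}}p_n$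 with $n\ge 2$. A computon is connected if for each $p\in \mathrm{Im}(s)\cup P^+$ there is $q\in P^-$ with $p\xrightarrow{\exists}q$. A computon morphism $\alpha:\lambda_1\to\lambda_2$ is a natural transformation (functions $\alpha_U,\alpha_P,\alpha_I,\alpha_O,\alpha_\Sigma$ commuting with $\sigma,\tau,t,s,c$) such that $\alpha_\Sigma$ is the inclusion $\Sigma_1\subseteq\Sigma_2$ and $\vec{i}(\alpha)\cup\vec{o}(\alpha)\subseteq P_1^+\cup P_1^-$, where $\vec{i}(\alpha)=\{p\in P_1\mid \bullet\alpha(p)\setminus\alpha(\bullet p)\ne\emptyset\}$ and $\vec{o}(\alpha)=\{p\in P_1\mid \alpha(p)\bullet\setminus\alpha(p\bullet)\neq\emptyset\}$. Computons and computon morphisms form the category $\mathbf{Set}^{\mathbf{Comp}}$ (componentwise composition). A p-async computon is the coproduct in $\mathbf{Set}^{\mathbf{Comp}}$ of two connected computons; for connected $\lambda_1,\lambda_2$ it is denoted $\lambda_1+\lambda_2$. (So "the p-async computon $\lambda_1+\lambda_2$ exists" means that $\lambda_1+\lambda_2$ exists and qualifies as a p-async computon.) -}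

module Defs where

open import Data.Fin.Base using (Fin)
import Data.Fin.Properties as Fin
open import Data.List.Base using (List)
import Data.List.Membership.Propositional as List
open import Data.Nat.Base using (ℕ)
open import Data.Product.Base using (∃; _×_; _,_; proj₁; proj₂)
import Data.Sum.Base as Sum
open import Function.Base using (_∘_)
import Function.Base as Fun
open import Function.Bundles using (_↔_; module Inverse)
open import Function.Definitions using (StrictlySurjective)
open import Function.Properties.Inverse using (↔⇒↣)
open import Level using (0ℓ)
open import Relation.Binary.Construct.Closure.Transitive using (TransClosure)
open import Relation.Binary.Definitions using (DecidableEquality)
open import Relation.Binary.PropositionalEquality
  using (_≡_; refl; sym; trans; cong; subst)
open import Relation.Nullary using (Dec; yes; no; contradiction; _×-dec_)
open import Relation.Nullary.Decidable using (map′)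
open import Relation.Unary
  using (Pred; Decidable; Satisfiable; _∈_; _⊆_; _≐_; _∪_; _∖_; ∁)

------------------------------------------------------------------------
-- Finite sets and images

Finite : Set → Set
Finite A = ∃ λ n → A ↔ Fin n

module _ {A : Set} (fin : Finite A) where
  private module F = Inverse (proj₂ fin)

  finite-≟ : DecidableEquality A
  finite-≟ = Fin.eq? (↔⇒↣ (proj₂ fin))

  finite-any? : {Q : Pred A 0ℓ} → Decidable Q → Dec (∃ Q)
  finite-any? {Q} Q? = map′
    (λ (i , q) → F.from i , q)
    (λ (a , q) → F.to a , subst Q (sym (F.strictlyInverseʳ a)) q)
    (Fin.any? (Q? ∘ F.from))

FiniteSubset : Pred ℕ 0ℓ → Set
FiniteSubset S = ∃ λ (ns : List ℕ) → S ≐ (List._∈ ns)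

Im : {A B : Set} → (A → B) → Pred B 0ℓ
Im f b = ∃ λ a → f a ≡ b

infix 9 _⟦_⟧
_⟦_⟧ : {A B : Set} → (A → B) → Pred A 0ℓ → Pred B 0ℓ
(f ⟦ S ⟧) b = ∃ λ a → a ∈ S × f a ≡ b

------------------------------------------------------------------------
-- Computons

-- The set of colours is a subset of ℕ, so a map into it is a map c into ℕ
-- together with a proof that its values are colours.
record Computon : Set₁ where
  field
    U P I O : Set
    Σ       : Pred ℕ 0ℓ

    U-finite : Finite U
    P-finite : Finite P
    I-finite : Finite I
    O-finite : Finite O
    Σ-finite : FiniteSubset Σ

    P-nonempty : P
    0∈Σ        : 0 ∈ Σ

    σ : O → U
    τ : I → U
    t : O → P
    s : I → P
    c : P → ℕ

    c∈Σ : ∀ p → c p ∈ Σ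

    σ-surjective : StrictlySurjective _≡_ σ
    τ-surjective : StrictlySurjective _≡_ τ
    c-surjective : Σ ⊆ Im c

    σ₀-surjective : ∀ u → u ∈ σ ⟦ (λ o → c (t o) ≡ 0) ⟧
    τ₀-surjective : ∀ u → u ∈ τ ⟦ (λ i → c (s i) ≡ 0) ⟧

  P⁺ : Pred P 0ℓ
  P⁺ = ∁ (Im t)

  P⁻ : Pred P 0ℓ
  P⁻ = ∁ (Im s)

  field
    control-outport : ∃ λ p → p ∈ P⁻ × c p ≡ 0
    control-inport  : ∃ λ q → q ∈ P⁺ × c q ≡ 0

  infix 4 _—[_]→ᵢ_ _—[_]→ₒ_ _⟶∃_
  infix 10 •_ _•

  _—[_]→ᵢ_ : P → I → U → Set
  p —[ i ]→ᵢ u = s i ≡ p × τ i ≡ u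

  _—[_]→ₒ_ : U → O → P → Set
  u —[ o ]→ₒ p = σ o ≡ u × t o ≡ p

  •_ : P → Pred U 0ℓ
  (• p) u = ∃ λ o → u —[ o ]→ₒ p

  _• : P → Pred U 0ℓ
  (p •) u = ∃ λ i → p —[ i ]→ᵢ u

  Step : P → P → Set
  Step p q = ∃ λ i → ∃ λ u → ∃ λ o → p —[ i ]→ᵢ u × u —[ o ]→ₒ q

  -- At least one step, i.e. a chain through n ≥ 2 ports.
  _⟶∃_ : P → P → Set
  _⟶∃_ = TransClosure Step

  Connected : Set
  Connected = ∀ p → p ∈ Im s ∪ P⁺ → ∃ λ q → q ∈ P⁻ × p ⟶∃ q

open Computon using (Connected) public

------------------------------------------------------------------------
-- The category of computons

-- The colour component of a morphism is an inclusion, hence carries no data: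
-- it is recorded by Σ-⊆, and its naturality square is c-natural.
record _⇒_ (Λ₁ Λ₂ : Computon) : Set where
  private
    module A = Computon Λ₁
    module B = Computon Λ₂
  field
    mapU : A.U → B.U
    mapP : A.P → B.P
    mapI : A.I → B.I
    mapO : A.O → B.O
    Σ-⊆  : A.Σ ⊆ B.Σ

    σ-natural : ∀ o → mapU (A.σ o) ≡ B.σ (mapO o)
    τ-natural : ∀ i → mapU (A.τ i) ≡ B.τ (mapI i)
    t-natural : ∀ o → mapP (A.t o) ≡ B.t (mapO o)
    s-natural : ∀ i → mapP (A.s i) ≡ B.s (mapI i)
    c-natural : ∀ p → A.c p ≡ B.c (mapP p)

  i⃗ : Pred A.P 0ℓ
  i⃗ p = Satisfiable (B.• (mapP p) ∖ mapU ⟦ A.• p ⟧)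

  o⃗ : Pred A.P 0ℓ
  o⃗ p = Satisfiable ((mapP p) B.• ∖ mapU ⟦ p A.• ⟧)

  field
    boundary : i⃗ ∪ o⃗ ⊆ A.P⁺ ∪ A.P⁻

infix 4 _⇒_ _≈_
infixr 9 _⊙_

record _≈_ {Λ₁ Λ₂ : Computon} (f g : Λ₁ ⇒ Λ₂) : Set where
  private
    module f = _⇒_ f
    module g = _⇒_ g
  field
    ≈U : ∀ u → f.mapU u ≡ g.mapU u
    ≈P : ∀ p → f.mapP p ≡ g.mapP p
    ≈I : ∀ i → f.mapI i ≡ g.mapI i
    ≈O : ∀ o → f.mapO o ≡ g.mapO o

idₘ : {Λ : Computon} → Λ ⇒ Λ
idₘ = record
  { mapU = Fun.id ; mapP = Fun.id ; mapI = Fun.id ; mapO = Fun.id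
  ; Σ-⊆ = Fun.id
  ; σ-natural = λ _ → refl
  ; τ-natural = λ _ → refl
  ; t-natural = λ _ → refl
  ; s-natural = λ _ → refl
  ; c-natural = λ _ → refl
  ; boundary = λ
      { (Sum.inj₁ (u , u∈ , u∉)) → contradiction (u , u∈ , refl) u∉
      ; (Sum.inj₂ (u , u∈ , u∉)) → contradiction (u , u∈ , refl) u∉ }
  }

_⊙_ : {Λ₁ Λ₂ Λ₃ : Computon} → Λ₂ ⇒ Λ₃ → Λ₁ ⇒ Λ₂ → Λ₁ ⇒ Λ₃
_⊙_ {Λ₁} {Λ₂} {Λ₃} g f = record
  { mapU = g.mapU ∘ f.mapU
  ; mapP = g.mapP ∘ f.mapP
  ; mapI = g.mapI ∘ f.mapI
  ; mapO = g.mapO ∘ f.mapO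
  ; Σ-⊆ = g.Σ-⊆ ∘ f.Σ-⊆
  ; σ-natural = λ o → trans (cong g.mapU (f.σ-natural o)) (g.σ-natural (f.mapO o))
  ; τ-natural = λ i → trans (cong g.mapU (f.τ-natural i)) (g.τ-natural (f.mapI i))
  ; t-natural = λ o → trans (cong g.mapP (f.t-natural o)) (g.t-natural (f.mapO o))
  ; s-natural = λ i → trans (cong g.mapP (f.s-natural i)) (g.s-natural (f.mapI i))
  ; c-natural = λ p → trans (f.c-natural p) (g.c-natural (f.mapP p))
  ; boundary = Sum.[ in-boundary , out-boundary ]
  }
  where
  module A = Computon Λ₁
  module B = Computon Λ₂
  module C = Computon Λ₃
  module f = _⇒_ f
  module g = _⇒_ g

  _∈•?_ : ∀ u p → Dec (u ∈ B.• p)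
  u ∈•? p = finite-any? B.O-finite λ o →
    finite-≟ B.U-finite (B.σ o) u ×-dec finite-≟ B.P-finite (B.t o) p

  _∈?_• : ∀ u p → Dec (u ∈ p B.•)
  u ∈? p • = finite-any? B.I-finite λ i →
    finite-≟ B.P-finite (B.s i) p ×-dec finite-≟ B.U-finite (B.τ i) u

  reflect : ∀ {p} → f.mapP p ∈ B.P⁺ ∪ B.P⁻ → p ∈ A.P⁺ ∪ A.P⁻
  reflect = Sum.map
    (λ fp∉ (o , to≡p) → fp∉ (f.mapO o , trans (sym (f.t-natural o)) (cong f.mapP to≡p)))
    (λ fp∉ (i , si≡p) → fp∉ (f.mapI i , trans (sym (f.s-natural i)) (cong f.mapP si≡p)))

  in-boundary : ∀ {p} →
    Satisfiable (C.• (g.mapP (f.mapP p)) ∖ (g.mapU ∘ f.mapU) ⟦ A.• p ⟧) →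
    p ∈ A.P⁺ ∪ A.P⁻
  in-boundary {p} (w , w∈ , w∉)
    with finite-any? B.U-finite
           (λ v → (v ∈•? f.mapP p) ×-dec finite-≟ C.U-finite (g.mapU v) w)
  ... | no  ∄v             = reflect (g.boundary (Sum.inj₁ (w , w∈ , ∄v)))
  ... | yes (v , v∈ , gv≡w) = f.boundary (Sum.inj₁
    (v , v∈ , λ (u , u∈ , fu≡v) → w∉ (u , u∈ , trans (cong g.mapU fu≡v) gv≡w)))

  out-boundary : ∀ {p} →
    Satisfiable ((g.mapP (f.mapP p)) C.• ∖ (g.mapU ∘ f.mapU) ⟦ p A.• ⟧) →
    p ∈ A.P⁺ ∪ A.P⁻
  out-boundary {p} (w , w∈ , w∉)
    with finite-any? B.U-finite
           (λ v → (v ∈? f.mapP p •) ×-dec finite-≟ C.U-finite (g.mapU v) w)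
  ... | no  ∄v             = reflect (g.boundary (Sum.inj₂ (w , w∈ , ∄v)))
  ... | yes (v , v∈ , gv≡w) = f.boundary (Sum.inj₂
    (v , v∈ , λ (u , u∈ , fu≡v) → w∉ (u , u∈ , trans (cong g.mapU fu≡v) gv≡w)))

record IsCoproduct (Λ₁ Λ₂ Λ : Computon) : Set₁ where
  field
    ι₁ : Λ₁ ⇒ Λ
    ι₂ : Λ₂ ⇒ Λ
    [_,_] : ∀ {M} → Λ₁ ⇒ M → Λ₂ ⇒ M → Λ ⇒ M
    inject₁ : ∀ {M} {f : Λ₁ ⇒ M} {g : Λ₂ ⇒ M} → [ f , g ] ⊙ ι₁ ≈ f
    inject₂ : ∀ {M} {f : Λ₁ ⇒ M} {g : Λ₂ ⇒ M} → [ f , g ] ⊙ ι₂ ≈ g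
    unique  : ∀ {M} {f : Λ₁ ⇒ M} {g : Λ₂ ⇒ M} {h : Λ ⇒ M} →
              h ⊙ ι₁ ≈ f → h ⊙ ι₂ ≈ g → h ≈ [ f , g ]

------------------------------------------------------------------------
-- P-async computons

IsPAsync : Computon → Set₁
IsPAsync Λ = ∃ λ M₁ → ∃ λ M₂ →
  Connected M₁ × Connected M₂ × IsCoproduct M₁ M₂ Λ

-- The coproduct of Λ₁ and Λ₂ exists and is a p-async computon. The connected
-- computons witnessing the latter are not required to be Λ₁ and Λ₂ themselves.
PAsyncSumExists : Computon → Computon → Set₁
PAsyncSumExists Λ₁ Λ₂ = ∃ λ Λ → IsCoproduct Λ₁ Λ₂ Λ × IsPAsync Λ

{-# OPTIONS --safe #-}

-- Connectedness only says that ports lead to e-outports, so it can be tested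
-- summand by summand on a disjoint union: a morphism along which all edges at
-- a port or unit in its image lift both preserves and reflects paths to
-- e-outports. The disjoint union is a coproduct, and an isomorphism lifts
-- edges. Hence if Λ is a coproduct of Λ₁, Λ₂ and also of connected M₁, M₂,
-- then the morphisms Λᵢ → Λ₁ ⊕ Λ₂ ≅ Λ ≅ M₁ ⊕ M₂ lift edges, and
-- connectedness of M₁ ⊕ M₂ passes to each Λᵢ.

module Submission where

open import Defs
open import Data.Fin.Properties using (+↔⊎)
import Data.List.Base as List using (_++_)
open import Data.List.Membership.Propositional.Properties using (∈-++⁺ˡ; ∈-++⁺ʳ; ∈-++⁻)
open import Data.Product.Base using (∃; _×_; _,_; proj₁)
import Data.Product.Base as Product
open import Data.Sum.Base using (_⊎_; inj₁; inj₂)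
import Data.Sum.Base as Sum
open import Data.Sum.Function.Propositional using (_⊎-↔_)
open import Data.Sum.Properties using (inj₁-injective; inj₂-injective)
open import Function.Base using (_∘_; id)
open import Function.Bundles using (_⇔_; mk⇔; module Equivalence)
open import Function.Properties.Inverse using (↔-sym; ↔-trans)
open import Level using (0ℓ)
open import Relation.Binary.Construct.Closure.Transitive using ([_]; _∷_)
open import Relation.Binary.PropositionalEquality
  using (_≡_; refl; sym; trans; cong)
open import Relation.Nullary using (contradiction)
open import Relation.Unary using (Pred; _∈_; _∪_)

-- Finiteness of disjoint unions and of united colour sets.

finite-⊎ : {A B : Set} → Finite A → Finite B → Finite (A ⊎ B)
finite-⊎ (_ , A↔) (_ , B↔) = _ , ↔-trans (A↔ ⊎-↔ B↔) (↔-sym +↔⊎)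

finiteSubset-∪ : ∀ {S T} → FiniteSubset S → FiniteSubset T → FiniteSubset (S ∪ T)
finiteSubset-∪ (xs , S⊆ , ⊆S) (ys , T⊆ , ⊆T) =
  xs List.++ ys
  , Sum.[ ∈-++⁺ˡ ∘ S⊆ , ∈-++⁺ʳ xs ∘ T⊆ ]
  , Sum.map ⊆S ⊆T ∘ ∈-++⁻ xs

-- Morphisms that lift edges, and paths to e-outports.

module _ (Λ : Computon) where
  open Computon Λ

  LeadsOut : Pred P 0ℓ
  LeadsOut p = ∃ λ q → q ∈ P⁻ × p ⟶∃ q

-- A lift must sit at the given port or unit of `Λ₁`, not merely over its image. Lifting along `s`
-- and `σ` lets a path be traced forward edge by edge; lifting along `t` keeps e-inports free of
-- incoming edges.
record LiftsEdges {Λ₁ Λ₂ : Computon} (f : Λ₁ ⇒ Λ₂) : Set where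
  private
    module A = Computon Λ₁
    module B = Computon Λ₂
    module f = _⇒_ f
  field
    lift-s : ∀ {p i} → B.s i ≡ f.mapP p → ∃ λ j → A.s j ≡ p × f.mapI j ≡ i
    lift-t : ∀ {p o} → B.t o ≡ f.mapP p → ∃ λ j → A.t j ≡ p × f.mapO j ≡ o
    lift-σ : ∀ {u o} → B.σ o ≡ f.mapU u → ∃ λ j → A.σ j ≡ u × f.mapO j ≡ o

  lift-Step : ∀ {p q} → B.Step (f.mapP p) q → ∃ λ q′ → f.mapP q′ ≡ q × A.Step p q′
  lift-Step (i , u , o , (si≡fp , τi≡u) , (σo≡u , to≡q)) with lift-s si≡fp
  -- By naturality of `τ` the lifted edge `j` ends at a unit over `u`, so `o` starts at the image of
  -- `A.τ j` and lifts to an edge leaving that very unit.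
  ... | j , sj≡p , refl with lift-σ (trans σo≡u (trans (sym τi≡u) (sym (f.τ-natural j))))
  ... | k , σk≡τj , refl =
    A.t k , trans (f.t-natural k) to≡q
    , j , A.τ j , k , (sj≡p , refl) , (σk≡τj , refl)

  lift-⟶∃ : ∀ {p q} → f.mapP p B.⟶∃ q → ∃ λ q′ → f.mapP q′ ≡ q × p A.⟶∃ q′
  lift-⟶∃ [ x ] = Product.map₂ (Product.map₂ [_]) (lift-Step x)
  lift-⟶∃ (x ∷ xs) with lift-Step x
  ... | _ , refl , y = Product.map₂ (Product.map₂ (y ∷_)) (lift-⟶∃ xs)

  preserves-P⁺ : ∀ {p} → p ∈ A.P⁺ → f.mapP p ∈ B.P⁺
  preserves-P⁺ p∉ (_ , to≡fp) with lift-t to≡fp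
  ... | j , tj≡p , _ = p∉ (j , tj≡p)

  preserves-P⁻ : ∀ {p} → p ∈ A.P⁻ → f.mapP p ∈ B.P⁻
  preserves-P⁻ p∉ (_ , si≡fp) with lift-s si≡fp
  ... | j , sj≡p , _ = p∉ (j , sj≡p)

  preserves-⟶∃ : ∀ {p q} → p A.⟶∃ q → f.mapP p B.⟶∃ f.mapP q
  preserves-⟶∃ = map
    where
    step : ∀ {p q} → A.Step p q → B.Step (f.mapP p) (f.mapP q)
    step (i , u , o , (refl , refl) , (σo≡u , refl)) =
      f.mapI i , f.mapU u , f.mapO o
      , (sym (f.s-natural i) , sym (f.τ-natural i))
      , (trans (sym (f.σ-natural o)) (cong f.mapU σo≡u) , sym (f.t-natural o))

    map : ∀ {p q} → p A.⟶∃ q → f.mapP p B.⟶∃ f.mapP q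
    map [ x ]    = [ step x ]
    map (x ∷ xs) = step x ∷ map xs

  preserves-LeadsOut : ∀ {p} → p ∈ LeadsOut Λ₁ → f.mapP p ∈ LeadsOut Λ₂
  preserves-LeadsOut (q , q∈ , p⟶q) = f.mapP q , preserves-P⁻ q∈ , preserves-⟶∃ p⟶q

  -- The path lifts step by step from `p`. Its endpoint `q` is an e-outport because an edge leaving
  -- `q` would be carried to one leaving the e-outport `f.mapP q`.
  reflects-LeadsOut : ∀ {p} → f.mapP p ∈ LeadsOut Λ₂ → p ∈ LeadsOut Λ₁
  reflects-LeadsOut (_ , fq∉ , fp⟶) with lift-⟶∃ fp⟶
  ... | q , refl , p⟶q =
    q , (λ (i , si≡q) → fq∉ (f.mapI i , trans (sym (f.s-natural i)) (cong f.mapP si≡q))) , p⟶q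

  preserves-source : ∀ {p} → p ∈ Im A.s ∪ A.P⁺ → f.mapP p ∈ Im B.s ∪ B.P⁺
  preserves-source = Sum.map
    (λ (i , si≡p) → f.mapI i , trans (sym (f.s-natural i)) (cong f.mapP si≡p))
    preserves-P⁺

  reflects-source : ∀ {p} → f.mapP p ∈ Im B.s ∪ B.P⁺ → p ∈ Im A.s ∪ A.P⁺
  reflects-source = Sum.map
    (λ (_ , si≡fp) → Product.map₂ proj₁ (lift-s si≡fp))
    (λ fp∉ (o , to≡p) → fp∉ (f.mapO o , trans (sym (f.t-natural o)) (cong f.mapP to≡p)))

  reflects-Connected : Connected Λ₂ → Connected Λ₁
  reflects-Connected conn p = reflects-LeadsOut ∘ conn (f.mapP p) ∘ preserves-source

-- Uniqueness of coproducts up to isomorphism.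

≈-sym : ∀ {Λ M} {f g : Λ ⇒ M} → f ≈ g → g ≈ f
≈-sym f≈g = record
  { ≈U = sym ∘ ≈U ; ≈P = sym ∘ ≈P ; ≈I = sym ∘ ≈I ; ≈O = sym ∘ ≈O }
  where open _≈_ f≈g

≈-trans : ∀ {Λ M} {f g h : Λ ⇒ M} → f ≈ g → g ≈ h → f ≈ h
≈-trans f≈g g≈h = record
  { ≈U = λ u → trans (f.≈U u) (g.≈U u)
  ; ≈P = λ p → trans (f.≈P p) (g.≈P p)
  ; ≈I = λ i → trans (f.≈I i) (g.≈I i)
  ; ≈O = λ o → trans (f.≈O o) (g.≈O o)
  }
  where
  module f = _≈_ f≈g
  module g = _≈_ g≈h

-- The lift of an edge is its image under the inverse `g`: `g ⊙ f ≈ idₘ` places it at the required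
-- port or unit, `f ⊙ g ≈ idₘ` over the given edge.
iso⇒liftsEdges : ∀ {Λ M} {f : Λ ⇒ M} {g : M ⇒ Λ} →
                 g ⊙ f ≈ idₘ → f ⊙ g ≈ idₘ → LiftsEdges f
iso⇒liftsEdges {f = f} {g} gf≈id fg≈id = record
  { lift-s = λ {_} {i} e → g.mapI i
      , trans (sym (g.s-natural i)) (trans (cong g.mapP e) (gf.≈P _)) , fg.≈I i
  ; lift-t = λ {_} {o} e → g.mapO o
      , trans (sym (g.t-natural o)) (trans (cong g.mapP e) (gf.≈P _)) , fg.≈O o
  ; lift-σ = λ {_} {o} e → g.mapO o
      , trans (sym (g.σ-natural o)) (trans (cong g.mapU e) (gf.≈U _)) , fg.≈O o
  }
  where
  module g = _⇒_ g
  module gf = _≈_ gf≈id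
  module fg = _≈_ fg≈id

module _ {Λ₁ Λ₂ : Computon} where

  comparison : ∀ {Λ M} → IsCoproduct Λ₁ Λ₂ Λ → IsCoproduct Λ₁ Λ₂ M → Λ ⇒ M
  comparison Λ+ M+ = IsCoproduct.[_,_] Λ+ (IsCoproduct.ι₁ M+) (IsCoproduct.ι₂ M+)

  -- Both the composite and the identity fix the two injections of `Λ`, so each equals the copairing
  -- of these injections.
  comparison-inverse : ∀ {Λ M} (Λ+ : IsCoproduct Λ₁ Λ₂ Λ) (M+ : IsCoproduct Λ₁ Λ₂ M) →
                       comparison M+ Λ+ ⊙ comparison Λ+ M+ ≈ idₘ
  comparison-inverse Λ+ M+ =
    ≈-trans
      (Λ+.unique {h = comparison M+ Λ+ ⊙ comparison Λ+ M+}
        (round-trip Λ+.inject₁ M+.inject₁) (round-trip Λ+.inject₂ M+.inject₂))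
      (≈-sym (Λ+.unique {h = idₘ} (id-⊙ {f = Λ+.ι₁}) (id-⊙ {f = Λ+.ι₂})))
    where
    module Λ+ = IsCoproduct Λ+
    module M+ = IsCoproduct M+

    round-trip : ∀ {A B C} {ι : A ⇒ B} {κ : A ⇒ C} {φ : B ⇒ C} {ψ : C ⇒ B} →
                 φ ⊙ ι ≈ κ → ψ ⊙ κ ≈ ι → (ψ ⊙ φ) ⊙ ι ≈ ι
    round-trip {ψ = ψ} φι≈κ ψκ≈ι = record
      { ≈U = λ x → trans (cong ψ.mapU (φι.≈U x)) (ψκ.≈U x)
      ; ≈P = λ x → trans (cong ψ.mapP (φι.≈P x)) (ψκ.≈P x)
      ; ≈I = λ x → trans (cong ψ.mapI (φι.≈I x)) (ψκ.≈I x)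
      ; ≈O = λ x → trans (cong ψ.mapO (φι.≈O x)) (ψκ.≈O x)
      }
      where
      module ψ = _⇒_ ψ
      module φι = _≈_ φι≈κ
      module ψκ = _≈_ ψκ≈ι

    id-⊙ : ∀ {A B} {f : A ⇒ B} → idₘ ⊙ f ≈ f
    id-⊙ = record
      { ≈U = λ _ → refl ; ≈P = λ _ → refl ; ≈I = λ _ → refl ; ≈O = λ _ → refl }

  connected-unique : ∀ {Λ M} → IsCoproduct Λ₁ Λ₂ Λ → IsCoproduct Λ₁ Λ₂ M →
                     Connected M → Connected Λ
  connected-unique Λ+ M+ = LiftsEdges.reflects-Connected
    (iso⇒liftsEdges {f = comparison Λ+ M+} {g = comparison M+ Λ+}
      (comparison-inverse Λ+ M+) (comparison-inverse M+ Λ+))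

-- The disjoint union as a coproduct.

module _ (Λ₁ Λ₂ : Computon) where
  private
    module A = Computon Λ₁
    module B = Computon Λ₂

  infixr 6 _⊕_

  -- Colour sets are united rather than made disjoint: morphisms act on colours by inclusion of
  -- subsets of `ℕ`, so a colour of both computons is identified.
  _⊕_ : Computon
  _⊕_ = record
    { U = A.U ⊎ B.U
    ; P = A.P ⊎ B.P
    ; I = A.I ⊎ B.I
    ; O = A.O ⊎ B.O
    ; Σ = A.Σ ∪ B.Σ
    ; U-finite = finite-⊎ A.U-finite B.U-finite
    ; P-finite = finite-⊎ A.P-finite B.P-finite
    ; I-finite = finite-⊎ A.I-finite B.I-finite
    ; O-finite = finite-⊎ A.O-finite B.O-finite
    ; Σ-finite = finiteSubset-∪ A.Σ-finite B.Σ-finite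
    ; P-nonempty = inj₁ A.P-nonempty
    ; 0∈Σ = inj₁ A.0∈Σ
    ; σ = Sum.map A.σ B.σ
    ; τ = Sum.map A.τ B.τ
    ; t = Sum.map A.t B.t
    ; s = Sum.map A.s B.s
    ; c = Sum.[ A.c , B.c ]
    ; c∈Σ = Sum.[ inj₁ ∘ A.c∈Σ , inj₂ ∘ B.c∈Σ ]
    ; σ-surjective = Sum.[ Product.map inj₁ (cong inj₁) ∘ A.σ-surjective
                         , Product.map inj₂ (cong inj₂) ∘ B.σ-surjective ]
    ; τ-surjective = Sum.[ Product.map inj₁ (cong inj₁) ∘ A.τ-surjective
                         , Product.map inj₂ (cong inj₂) ∘ B.τ-surjective ]
    ; c-surjective = Sum.[ Product.map inj₁ id ∘ A.c-surjective
                         , Product.map inj₂ id ∘ B.c-surjective ]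
    ; σ₀-surjective =
        Sum.[ Product.map inj₁ (Product.map₂ (cong inj₁)) ∘ A.σ₀-surjective
            , Product.map inj₂ (Product.map₂ (cong inj₂)) ∘ B.σ₀-surjective ]
    ; τ₀-surjective =
        Sum.[ Product.map inj₁ (Product.map₂ (cong inj₁)) ∘ A.τ₀-surjective
            , Product.map inj₂ (Product.map₂ (cong inj₂)) ∘ B.τ₀-surjective ]
    -- The control ports are those of `Λ₁`; no edge of the right summand meets a port of the left
    -- one.
    ; control-outport = let (p , p∉ , cp≡0) = A.control-outport in
        inj₁ p , (λ { (inj₁ i , e) → p∉ (i , inj₁-injective e) }) , cp≡0
    ; control-inport = let (p , p∉ , cp≡0) = A.control-inport in
        inj₁ p , (λ { (inj₁ o , e) → p∉ (o , inj₁-injective e) }) , cp≡0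
    }

module _ {Λ₁ Λ₂ : Computon} where
  private
    module A = Computon Λ₁
    module B = Computon Λ₂

  -- Every unit adjacent to `inj₁ p` comes from a unit adjacent to `p`, so `i⃗` and `o⃗` are empty
  -- and the boundary condition is vacuous.
  inl : Λ₁ ⇒ Λ₁ ⊕ Λ₂
  inl = record
    { mapU = inj₁ ; mapP = inj₁ ; mapI = inj₁ ; mapO = inj₁
    ; Σ-⊆ = inj₁
    ; σ-natural = λ _ → refl
    ; τ-natural = λ _ → refl
    ; t-natural = λ _ → refl
    ; s-natural = λ _ → refl
    ; c-natural = λ _ → refl
    ; boundary = λ
        { (inj₁ (_ , (inj₁ o , σo≡ , to≡) , ∉)) →
            contradiction (A.σ o , (o , refl , inj₁-injective to≡) , σo≡) ∉
        ; (inj₂ (_ , (inj₁ i , si≡ , τi≡) , ∉)) →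
            contradiction (A.τ i , (i , inj₁-injective si≡ , refl) , τi≡) ∉ }
    }

  inr : Λ₂ ⇒ Λ₁ ⊕ Λ₂
  inr = record
    { mapU = inj₂ ; mapP = inj₂ ; mapI = inj₂ ; mapO = inj₂
    ; Σ-⊆ = inj₂
    ; σ-natural = λ _ → refl
    ; τ-natural = λ _ → refl
    ; t-natural = λ _ → refl
    ; s-natural = λ _ → refl
    ; c-natural = λ _ → refl
    ; boundary = λ
        { (inj₁ (_ , (inj₂ o , σo≡ , to≡) , ∉)) →
            contradiction (B.σ o , (o , refl , inj₂-injective to≡) , σo≡) ∉
        ; (inj₂ (_ , (inj₂ i , si≡ , τi≡) , ∉)) →
            contradiction (B.τ i , (i , inj₂-injective si≡ , refl) , τi≡) ∉ }
    }

  -- The structure maps respect the tags, so an edge at an element tagged `inj₁` is itself tagged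
  -- `inj₁`.
  inl-liftsEdges : LiftsEdges inl
  inl-liftsEdges = record
    { lift-s = λ { {i = inj₁ i} e → i , inj₁-injective e , refl }
    ; lift-t = λ { {o = inj₁ o} e → o , inj₁-injective e , refl }
    ; lift-σ = λ { {o = inj₁ o} e → o , inj₁-injective e , refl }
    }

  inr-liftsEdges : LiftsEdges inr
  inr-liftsEdges = record
    { lift-s = λ { {i = inj₂ i} e → i , inj₂-injective e , refl }
    ; lift-t = λ { {o = inj₂ o} e → o , inj₂-injective e , refl }
    ; lift-σ = λ { {o = inj₂ o} e → o , inj₂-injective e , refl }
    }

  private
    module L = LiftsEdges inl-liftsEdges
    module R = LiftsEdges inr-liftsEdges

  copair : ∀ {M} → Λ₁ ⇒ M → Λ₂ ⇒ M → Λ₁ ⊕ Λ₂ ⇒ M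
  copair f g = record
    { mapU = Sum.[ f.mapU , g.mapU ]
    ; mapP = Sum.[ f.mapP , g.mapP ]
    ; mapI = Sum.[ f.mapI , g.mapI ]
    ; mapO = Sum.[ f.mapO , g.mapO ]
    ; Σ-⊆ = Sum.[ f.Σ-⊆ , g.Σ-⊆ ]
    ; σ-natural = Sum.[ f.σ-natural , g.σ-natural ]
    ; τ-natural = Sum.[ f.τ-natural , g.τ-natural ]
    ; t-natural = Sum.[ f.t-natural , g.t-natural ]
    ; s-natural = Sum.[ f.s-natural , g.s-natural ]
    ; c-natural = Sum.[ f.c-natural , g.c-natural ]
    -- A unit at `f.mapP p` missed by the units at `inj₁ p` is also missed by those at `p`, so `f`
    -- makes `p` an e-inport or e-outport of `Λ₁`. It remains one in the disjoint union because the
    -- injection lifts edges. The same holds for `g`.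
    ; boundary = λ
        { {inj₁ p} (inj₁ (w , w∈ , w∉)) → Sum.map L.preserves-P⁺ L.preserves-P⁻
            (f.boundary (inj₁ (w , w∈ , λ (u , (o , σo≡u , to≡p) , fu≡w) →
              w∉ (inj₁ u , (inj₁ o , cong inj₁ σo≡u , cong inj₁ to≡p) , fu≡w))))
        ; {inj₁ p} (inj₂ (w , w∈ , w∉)) → Sum.map L.preserves-P⁺ L.preserves-P⁻
            (f.boundary (inj₂ (w , w∈ , λ (u , (i , si≡p , τi≡u) , fu≡w) →
              w∉ (inj₁ u , (inj₁ i , cong inj₁ si≡p , cong inj₁ τi≡u) , fu≡w))))
        ; {inj₂ p} (inj₁ (w , w∈ , w∉)) → Sum.map R.preserves-P⁺ R.preserves-P⁻
            (g.boundary (inj₁ (w , w∈ , λ (u , (o , σo≡u , to≡p) , gu≡w) →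
              w∉ (inj₂ u , (inj₂ o , cong inj₂ σo≡u , cong inj₂ to≡p) , gu≡w))))
        ; {inj₂ p} (inj₂ (w , w∈ , w∉)) → Sum.map R.preserves-P⁺ R.preserves-P⁻
            (g.boundary (inj₂ (w , w∈ , λ (u , (i , si≡p , τi≡u) , gu≡w) →
              w∉ (inj₂ u , (inj₂ i , cong inj₂ si≡p , cong inj₂ τi≡u) , gu≡w)))) }
    }
    where
    module f = _⇒_ f
    module g = _⇒_ g

  ⊕-isCoproduct : IsCoproduct Λ₁ Λ₂ (Λ₁ ⊕ Λ₂)
  ⊕-isCoproduct = record
    { ι₁ = inl
    ; ι₂ = inr
    ; [_,_] = copair
    ; inject₁ = record
        { ≈U = λ _ → refl ; ≈P = λ _ → refl ; ≈I = λ _ → refl ; ≈O = λ _ → refl }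
    ; inject₂ = record
        { ≈U = λ _ → refl ; ≈P = λ _ → refl ; ≈I = λ _ → refl ; ≈O = λ _ → refl }
    ; unique = copair-unique
    }
    where
    copair-unique : ∀ {M} {f : Λ₁ ⇒ M} {g : Λ₂ ⇒ M} {h : Λ₁ ⊕ Λ₂ ⇒ M} →
                    h ⊙ inl ≈ f → h ⊙ inr ≈ g → h ≈ copair f g
    copair-unique h₁ h₂ = record
      { ≈U = Sum.[ _≈_.≈U h₁ , _≈_.≈U h₂ ]
      ; ≈P = Sum.[ _≈_.≈P h₁ , _≈_.≈P h₂ ]
      ; ≈I = Sum.[ _≈_.≈I h₁ , _≈_.≈I h₂ ]
      ; ≈O = Sum.[ _≈_.≈O h₁ , _≈_.≈O h₂ ]
      }

  -- Each port lies in one summand, where a path to an e-outport exists; the injection carries that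
  -- path into the disjoint union.
  ⊕-connected : Connected Λ₁ → Connected Λ₂ → Connected (Λ₁ ⊕ Λ₂)
  ⊕-connected conn₁ conn₂ = Sum.[
    (λ p → L.preserves-LeadsOut ∘ conn₁ p ∘ L.reflects-source) ,
    (λ p → R.preserves-LeadsOut ∘ conn₂ p ∘ R.reflects-source) ]

-- Connectedness of coproducts and of their summands.

coproduct-connected : ∀ {Λ₁ Λ₂ Λ} → IsCoproduct Λ₁ Λ₂ Λ →
                      (Connected Λ₁ × Connected Λ₂) ⇔ Connected Λ
coproduct-connected {Λ₁} {Λ₂} Λ+ = mk⇔
  (λ (conn₁ , conn₂) → connected-unique Λ+ ⊕-isCoproduct (⊕-connected {Λ₁} {Λ₂} conn₁ conn₂))
  -- Connectedness is first moved to the disjoint union, whose injections lift edges by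
  -- construction.
  (λ conn → let conn⊕ = connected-unique ⊕-isCoproduct Λ+ conn in
    LiftsEdges.reflects-Connected (inl-liftsEdges {Λ₁} {Λ₂}) conn⊕ ,
    LiftsEdges.reflects-Connected (inr-liftsEdges {Λ₁} {Λ₂}) conn⊕)

theorem2 : (Λ₁ Λ₂ : Computon) →
    (Connected Λ₁ × Connected Λ₂) ⇔ PAsyncSumExists Λ₁ Λ₂
theorem2 Λ₁ Λ₂ = mk⇔
  (λ (conn₁ , conn₂) →
    Λ₁ ⊕ Λ₂ , ⊕-isCoproduct , Λ₁ , Λ₂ , conn₁ , conn₂ , ⊕-isCoproduct)
  -- The connected summands in `M+` may differ from `Λ₁` and `Λ₂`; connectedness of the common
  -- coproduct links the two decompositions.
  (λ (_ , Λ+ , _ , _ , conn₁ , conn₂ , M+) →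
    Equivalence.from (coproduct-connected Λ+)
      (Equivalence.to (coproduct-connected M+) (conn₁ , conn₂)))
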